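{- Let $(G,\precsim)$ be a C-quasi-ordered group and let $g\in G$ be $o^+$-type. The type-component $T_g$ has the following properties: (a) $T_g$ is right-convex with convexity complement $F_g:=cl(g^{ -1})\setminus T_g$. Moreover, $cl(g^{ -1})=F_g\cup T_g^-$ and $F_g$ can only contain v-type elements. (b) $T_g$ is convex if and only if $g^{ -1}$ is not a welding point of $G$. (c) $T_g$ is the biggest strictly convex subset of $G$ containing $g$ with the following properties: (i) every element of $T_g$ is o-type; (ii) $T_g$ contains exactly one class of $o^-$-type elements, and this class is smaller than every $o^+$-type element of $T_g$. (d) For any $f_1,f_2,h\in T_g$ which are $o^+$-type, $f_1\precsim f_2$ implies $f_1h\precsim f_2h$ and $hf_1\precsim hf_2$.
   Context: A quasi-order is a reflexive, transitive and total binary relation $\precsim$; $a\sim b$ means $a\precsim b\precsim a$, $cl(a)$ is the $\sim$-class of $a$, and $a\precnsim b$ means $a\precsim b$ and $a\nsim b$. An element $c$ is between $a$ and $b$ if $a\precsim c\precsim b$ or $b\precsim c\precsim a$. A subset $S$ is convex (resp. strictly convex, right-convex) if for all $s,t\in S$, $s\precsim a\precsim t$ (resp. $s\precnsim a\precnsim t$, $s\precnsim a\precsim t$) implies $a\in S$. The convexity complement of a strictly convex set $S$ is the smallest set $T$ disjoint from $S$ such that $S\cup T$ is convex. A C-relation on a set is a ternary relation $C$ such that for all $x,y,z,w$: $C(x,y,z)\Rightarrow C(x,z,y)$; $C(x,y,z)\Rightarrow\neg C(y,x,z)$; $C(x,y,z)\Rightarrow C(w,y,z)\vee C(x,w,z)$;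 $x\neq y\Rightarrow C(x,y,y)$. On a group it is compatible if $C(x,y,z)$ implies $C(vxu,vyu,vzu)$ for all $x,y,z,u,v$. A C-quasi-order on a group $G$ is a quasi-order of the form $x\precsim y\Leftrightarrow\neg C(x,y,1)$ with $C$ a compatible C-relation; a C-quasi-ordered group is a group with a C-quasi-order. $g\in G$ is v-type if $g\sim g^{ -1}$; o-type if $g=1$ or $g\nsim g^{ -1}$; $o^+$-type if $g^{ -1}\precnsim g$; $o^-$-type if $g\precnsim g^{ -1}$. An element $h$ is a welding point of $G$ if there exists $g\sim h$ such that $g$ and $h$ are of different type (one is v-type, the other o-type). For $g$ $o^+$-type, $T_g^+$ is the set of $o^+$-type elements $h$ such that every element between $g$ and $h$ is $o^+$-type, $T_g^-:=\{h^{ -1}\mid h\in T_g^+\}$ and $T_g:=T_g^+\cup T_g^-$ (the type-component of $g$). "Exactly one class of $o^-$-type elements" means that there are $o^-$-type elements in the set and that they are all $\sim$-equivalent to one another.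
   Formalization: In (c), T_g is the biggest among subsets that moreover do not contain the identity 1: since 1 counts as o-type but lies in no T_g, the literal claim fails (e.g. in ℤ with its order-type C-relation and g = 1, all of ℤ has the listed properties while T_g = ℤ∖{0}). -}

module Defs where

open import Level using (Level; _⊔_) renaming (suc to lsuc)
open import Algebra.Bundles using (Group)
open import Data.Product using (_×_; ∃-syntax)
open import Data.Sum using (_⊎_)
open import Function.Bundles using (_⇔_)
open import Relation.Binary.Core using (Rel)
open import Relation.Binary.Structures using (IsTotalPreorder)
open import Relation.Nullary using (¬_)
open import Relation.Unary using (Pred; _∈_; _⊆_; _∪_; _∖_; _⊥_)

module _ {c ℓ : Level} (G : Group c ℓ) where
  open Group G

  -- The carrier is a setoid, so C must respect its equality.
  record IsCRelation {r} (C : Carrier → Carrier → Carrier → Set r)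
         : Set (c ⊔ ℓ ⊔ r) where
    field
      resp   : ∀ {x x′ y y′ z z′} → x ≈ x′ → y ≈ y′ → z ≈ z′ →
               C x y z → C x′ y′ z′
      swap   : ∀ x y z → C x y z → C x z y
      asym   : ∀ x y z → C x y z → ¬ C y x z
      branch : ∀ x y z w → C x y z → C w y z ⊎ C x w z
      leaf   : ∀ x y → ¬ x ≈ y → C x y y

  Compatible : ∀ {r} → (Carrier → Carrier → Carrier → Set r) → Set (c ⊔ r)
  Compatible C = ∀ x y z u v →
    C x y z → C (v ∙ x ∙ u) (v ∙ y ∙ u) (v ∙ z ∙ u)

  -- A quasi-order is a total preorder.
  record IsCQuasiOrder {r} (_≾_ : Rel Carrier r) : Set (c ⊔ ℓ ⊔ lsuc r) where
    field
      isTotalPreorder : IsTotalPreorder _≈_ _≾_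
      C               : Carrier → Carrier → Carrier → Set r
      isCRelation     : IsCRelation C
      compatible      : Compatible C
      ≾⇔¬C            : ∀ x y → x ≾ y ⇔ (¬ C x y ε)

record CQuasiOrderedGroup (c ℓ r : Level) : Set (lsuc (c ⊔ ℓ ⊔ r)) where
  infix 4 _≾_
  field
    group         : Group c ℓ
    _≾_           : Rel (Group.Carrier group) r
    isCQuasiOrder : IsCQuasiOrder group _≾_

  open Group group public
  open IsCQuasiOrder isCQuasiOrder public

module CQO {c ℓ r : Level} (𝓖 : CQuasiOrderedGroup c ℓ r) where
  open CQuasiOrderedGroup 𝓖 public

  -- Large enough a level for every set defined below.
  Subset : Set (lsuc (c ⊔ ℓ ⊔ r))
  Subset = Pred Carrier (c ⊔ ℓ ⊔ r)

  infix 4 _∼_ _⋨_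

  _∼_ : Rel Carrier r
  a ∼ b = a ≾ b × b ≾ a

  -- The strict part of ≾.
  _⋨_ : Rel Carrier r
  a ⋨ b = a ≾ b × ¬ (a ∼ b)

  cl : Carrier → Pred Carrier r
  cl a x = x ∼ a

  Between : Carrier → Carrier → Pred Carrier r
  Between a b x = (a ≾ x × x ≾ b) ⊎ (b ≾ x × x ≾ a)

  Convex : ∀ {p} → Pred Carrier p → Set (c ⊔ r ⊔ p)
  Convex S = ∀ {s t a} → s ∈ S → t ∈ S → s ≾ a → a ≾ t → a ∈ S

  StrictlyConvex : ∀ {p} → Pred Carrier p → Set (c ⊔ r ⊔ p)
  StrictlyConvex S = ∀ {s t a} → s ∈ S → t ∈ S → s ⋨ a → a ⋨ t → a ∈ S

  RightConvex : ∀ {p} → Pred Carrier p → Set (c ⊔ r ⊔ p)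
  RightConvex S = ∀ {s t a} → s ∈ S → t ∈ S → s ⋨ a → a ≾ t → a ∈ S

  record IsConvexityComplement (S T : Subset) : Set (lsuc (c ⊔ ℓ ⊔ r)) where
    field
      disjoint : S ⊥ T
      convex   : Convex (S ∪ T)
      smallest : (T′ : Subset) → S ⊥ T′ → Convex (S ∪ T′) → T ⊆ T′

  -- The identity is both v-type and o-type, and is neither o⁺- nor o⁻-type.
  VType : Pred Carrier r
  VType g = g ∼ g ⁻¹

  OType : Pred Carrier (ℓ ⊔ r)
  OType g = g ≈ ε ⊎ ¬ (g ∼ g ⁻¹)

  O⁺Type : Pred Carrier r
  O⁺Type g = g ⁻¹ ⋨ g

  O⁻Type : Pred Carrier r
  O⁻Type g = g ⋨ g ⁻¹

  WeldingPoint : Pred Carrier (c ⊔ ℓ ⊔ r)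
  WeldingPoint h =
    ∃[ g ] (g ∼ h × ((VType g × OType h) ⊎ (OType g × VType h)))

  T⁺ : Carrier → Pred Carrier (c ⊔ r)
  T⁺ g h = O⁺Type h × (∀ x → Between g h x → O⁺Type x)

  T⁻ : Carrier → Subset
  T⁻ g x = ∃[ h ] (h ∈ T⁺ g × x ≈ h ⁻¹)

  T : Carrier → Subset
  T g = T⁺ g ∪ T⁻ g

  F : Carrier → Subset
  F g = cl (g ⁻¹) ∖ T g

  -- There are o⁻-type elements in S, and all of them are equivalent.
  OneO⁻Class : Subset → Set (c ⊔ ℓ ⊔ r)
  OneO⁻Class S =
    (∃[ a ] (a ∈ S × O⁻Type a)) ×
    (∀ {a b} → a ∈ S → O⁻Type a → b ∈ S → O⁻Type b → a ∼ b)

  -- The identity has to be excluded: it is o-type, but lies in no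
  -- type-component.  For ℤ with x ≾ y iff neither (0 < x and y < x) nor
  -- (y = 0 and x ≠ 0), the component of 1 is ℤ ∖ {0}, whereas ℤ itself has
  -- all the properties other than avoids-ε.
  record IsOComponentCandidate (g : Carrier) (S : Subset)
         : Set (c ⊔ ℓ ⊔ r) where
    field
      strictlyConvex : StrictlyConvex S
      contains-g     : g ∈ S
      avoids-ε       : ∀ {x} → x ∈ S → ¬ x ≈ ε
      all-OType      : S ⊆ OType
      oneO⁻Class     : OneO⁻Class S
      O⁻-below-O⁺    : ∀ {a b} → a ∈ S → O⁻Type a → b ∈ S → O⁺Type b → a ⋨ b

  IsBiggest : (Subset → Set (c ⊔ ℓ ⊔ r)) → Subset → Set (lsuc (c ⊔ ℓ ⊔ r))
  IsBiggest P S = P S × ((S′ : Subset) → P S′ → S′ ⊆ S)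

-- Write a ≺ b for C b a ε, classically the negation of b ≾ a.  Everything rests on one
-- consequence of the C-relation axioms (⁻¹≺⇒≺): if a⁻¹ lies strictly below
-- both b and b⁻¹, then so does a.  Thus two intervals [x⁻¹, x], with x
-- ranging over the o⁺-type elements, are disjoint or have equivalent bottoms,
-- whence T⁺ g consists of the o⁺-type h with h⁻¹ ∼ g⁻¹ and T⁻ g of the
-- o⁻-type elements of cl (g⁻¹).  Parts (a)–(c) follow by comparing elements
-- with g⁻¹; in (d), h⁻¹ ≺ f₂ makes it possible to replace h⁻¹ by ε in
-- C f₁ f₂ h⁻¹.
{-# OPTIONS --safe #-}
module Submission where

open import Defs
open import Level using (Level; _⊔_; Lift; lift; lower)
open import Algebra.Properties.Group using (⁻¹-involutive; \\-leftDividesʳ; //-rightDividesˡ; //-rightDividesʳ)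
open import Axiom.ExcludedMiddle using (ExcludedMiddle)
open import Data.Empty using (⊥-elim)
open import Data.Product using (_×_; _,_; proj₁; proj₂; swap)
open import Data.Sum using (_⊎_; inj₁; inj₂; [_,_]′)
open import Function.Base using (_∘_; id)
open import Function.Bundles using (_⇔_; mk⇔; Equivalence)
open import Relation.Binary.Core using (Rel)
open import Relation.Binary.Structures using (module IsTotalPreorder)
open import Relation.Nullary using (¬_; Dec; yes; no)
open import Relation.Nullary.Decidable using (map′; decidable-stable)
open import Relation.Unary using (_∈_; _⊆_; _∪_; _≐_)

module Classical {c ℓ r : Level} (em : ExcludedMiddle (c ⊔ ℓ ⊔ r))
                 (𝓖 : CQuasiOrderedGroup c ℓ r) where
  open CQO 𝓖
  open IsCRelation isCRelation
    using (resp; asym; branch) renaming (swap to C-swap)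
  open IsTotalPreorder isTotalPreorder
    using (total) renaming (refl to ≾-refl; trans to ≾-trans; reflexive to ≈⇒≾)

  -- Classical order facts and the passage between `≾` and `C`.

  ⁻¹⁻¹ : ∀ x → x ⁻¹ ⁻¹ ≈ x
  ⁻¹⁻¹ = ⁻¹-involutive group

  dec : (P : Set r) → Dec P
  dec P = map′ lower lift (em {Lift (c ⊔ ℓ) P})

  ∼-sym : ∀ {a b} → a ∼ b → b ∼ a
  ∼-sym = swap

  ∼-trans : ∀ {a b c} → a ∼ b → b ∼ c → a ∼ c
  ∼-trans (p , q) (p′ , q′) = ≾-trans p p′ , ≾-trans q′ q

  ≈⇒∼ : ∀ {a b} → a ≈ b → a ∼ b
  ≈⇒∼ e = ≈⇒≾ e , ≈⇒≾ (sym e)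

  infix 4 _≺_

  -- The negated form makes the mixed transitivity laws immediate; `≺⇒C` and `C⇒≺` pass to and from
  -- `C b a ε`.
  _≺_ : Rel Carrier r
  a ≺ b = ¬ (b ≾ a)

  ≺⇒≾ : ∀ {a b} → a ≺ b → a ≾ b
  ≺⇒≾ {a} {b} a≺b = [ id , ⊥-elim ∘ a≺b ]′ (total a b)

  ≺⇒⋨ : ∀ {a b} → a ≺ b → a ⋨ b
  ≺⇒⋨ a≺b = ≺⇒≾ a≺b , a≺b ∘ proj₂

  ⋨⇒≺ : ∀ {a b} → a ⋨ b → a ≺ b
  ⋨⇒≺ (a≾b , a≁b) b≾a = a≁b (a≾b , b≾a)

  ≺-≾-trans : ∀ {a b c} → a ≺ b → b ≾ c → a ≺ c
  ≺-≾-trans a≺b b≾c c≾a = a≺b (≾-trans b≾c c≾a)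

  ≾-≺-trans : ∀ {a b c} → a ≾ b → b ≺ c → a ≺ c
  ≾-≺-trans a≾b b≺c c≾a = b≺c (≾-trans c≾a a≾b)

  ∼-dec : ∀ {a b} → ¬ (a ≺ b) → ¬ (b ≺ a) → a ∼ b
  ∼-dec ¬a≺b ¬b≺a =
    decidable-stable (dec _) ¬b≺a , decidable-stable (dec _) ¬a≺b

  ≺⇒C : ∀ {a b} → a ≺ b → C b a ε
  ≺⇒C a≺b = decidable-stable (dec _) (a≺b ∘ Equivalence.from (≾⇔¬C _ _))

  C⇒≺ : ∀ {a b} → C b a ε → a ≺ b
  C⇒≺ p b≾a = Equivalence.to (≾⇔¬C _ _) b≾a p

  -- With C (b a) a ε and C a (b a) b at hand, the branch axiom leaves only
  -- C b a ε.
  ⁻¹≺⇒≺ : ∀ {a b} → a ⁻¹ ≺ b → a ⁻¹ ≺ b ⁻¹ → a ≺ b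
  ⁻¹≺⇒≺ {a} {b} a⁻¹≺b a⁻¹≺b⁻¹ with branch _ _ _ b ba∣ε,a
    where
    ba∣ε,a : C (b ∙ a) ε a
    ba∣ε,a = resp (∙-congʳ (identityˡ b))
                  (trans (∙-congʳ (identityˡ _)) (inverseˡ a))
                  (trans (∙-congʳ (identityˡ ε)) (identityˡ a))
                  (compatible _ _ _ a ε (≺⇒C a⁻¹≺b))
  ... | inj₁ b∣ε,a  = C⇒≺ (C-swap _ _ _ b∣ε,a)
  ... | inj₂ ba∣b,a = ⊥-elim (asym _ _ _ (C-swap _ _ _ ba∣b,a) (C-swap _ _ _ a∣b,ba))
    where
    a∣b,ba : C a b (b ∙ a)
    a∣b,ba = resp (trans (∙-congʳ (inverseʳ b)) (identityˡ a))
                  (//-rightDividesˡ group a b)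
                  (∙-congʳ (identityʳ b))
                  (compatible _ _ _ a b (≺⇒C a⁻¹≺b⁻¹))

  ⁻¹≺⇒≺⁻¹ : ∀ {a b} → a ⁻¹ ≺ b → a ⁻¹ ≺ b ⁻¹ → a ≺ b ⁻¹
  ⁻¹≺⇒≺⁻¹ a⁻¹≺b a⁻¹≺b⁻¹ =
    ⁻¹≺⇒≺ a⁻¹≺b⁻¹ (≺-≾-trans a⁻¹≺b (≈⇒≾ (sym (⁻¹⁻¹ _))))

  -- Types of elements and the intervals `[x ⁻¹, x]`.

  O⁻⇒O⁺⁻¹ : ∀ {x} → O⁻Type x → O⁺Type (x ⁻¹)
  O⁻⇒O⁺⁻¹ x⁻ = ≺⇒⋨ (≾-≺-trans (≈⇒≾ (⁻¹⁻¹ _)) (⋨⇒≺ x⁻))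

  O⁺⇒O⁻⁻¹ : ∀ {x} → O⁺Type x → O⁻Type (x ⁻¹)
  O⁺⇒O⁻⁻¹ x⁺ = ≺⇒⋨ (≺-≾-trans (⋨⇒≺ x⁺) (≈⇒≾ (sym (⁻¹⁻¹ _))))

  O⁺⇒¬V : ∀ {x} → O⁺Type x → ¬ VType x
  O⁺⇒¬V x⁺ = proj₂ x⁺ ∘ ∼-sym

  O⁻⇒¬V : ∀ {x} → O⁻Type x → ¬ VType x
  O⁻⇒¬V = proj₂

  ε-VType : VType ε
  ε-VType = ≈⇒∼ (trans (sym (inverseʳ ε)) (identityˡ _))

  V-resp-≈ : ∀ {x y} → x ≈ y → VType x → VType y
  V-resp-≈ e x∼x⁻¹ = ∼-trans (≈⇒∼ (sym e)) (∼-trans x∼x⁻¹ (≈⇒∼ (⁻¹-cong e)))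

  ¬V⇒O⁺⊎O⁻ : ∀ {x} → ¬ VType x → O⁺Type x ⊎ O⁻Type x
  ¬V⇒O⁺⊎O⁻ {x} ¬v with total x (x ⁻¹)
  ... | inj₁ x≾x⁻¹ = inj₂ (x≾x⁻¹ , ¬v)
  ... | inj₂ x⁻¹≾x = inj₁ (x⁻¹≾x , ¬v ∘ ∼-sym)

  -- The case b ∼ x shows that a class of o⁺-type elements is never welded.
  O⁺-below : ∀ {b x} → b ⁻¹ ≺ x → x ≾ b → O⁺Type x
  -- If `x ≾ x ⁻¹`, then `b ⁻¹` is strictly below both, whence `b ≺ x`.
  O⁺-below b⁻¹≺x x≾b = ≺⇒⋨ λ x≾x⁻¹ →
    ⁻¹≺⇒≺ b⁻¹≺x (≺-≾-trans b⁻¹≺x x≾x⁻¹) x≾b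

  -- A strictly lower bottom would lie strictly below the other element and its inverse. By `⁻¹≺⇒≺`
  -- this forces `a ≺ b ⁻¹` or `b ≺ a`, each contrary to a hypothesis.
  ⁻¹-∼-of-overlap : ∀ {a b} → O⁺Type a → O⁺Type b → a ≾ b → b ⁻¹ ≺ a →
                    a ⁻¹ ∼ b ⁻¹
  ⁻¹-∼-of-overlap a⁺ b⁺ a≾b b⁻¹≺a = ∼-dec
    (λ a⁻¹≺b⁻¹ →
      ⁻¹≺⇒≺⁻¹ (≺-≾-trans a⁻¹≺b⁻¹ (≺⇒≾ (⋨⇒≺ b⁺))) a⁻¹≺b⁻¹ (≺⇒≾ b⁻¹≺a))
    (λ b⁻¹≺a⁻¹ → ⁻¹≺⇒≺ b⁻¹≺a b⁻¹≺a⁻¹ a≾b)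

  -- If `a ≾ b ⁻¹`, the o⁻-type element `b ⁻¹` would lie between `a` and `b`; so the intervals
  -- overlap.
  ⁻¹-∼-of-O⁺-interval : ∀ {a b} → O⁺Type a → O⁺Type b → a ≾ b →
                        (∀ x → a ≾ x → x ≾ b → O⁺Type x) → a ⁻¹ ∼ b ⁻¹
  ⁻¹-∼-of-O⁺-interval a⁺ b⁺ a≾b allO⁺ = ⁻¹-∼-of-overlap a⁺ b⁺ a≾b λ a≾b⁻¹ →
    ⋨⇒≺ (allO⁺ _ a≾b⁻¹ (≺⇒≾ (⋨⇒≺ b⁺))) (proj₁ (O⁺⇒O⁻⁻¹ b⁺))

  -- Membership in `T g` read off from the class of `g ⁻¹`.

  module Component (g : Carrier) (g⁺ : O⁺Type g) where

    g⁻¹≺g : g ⁻¹ ≺ g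
    g⁻¹≺g = ⋨⇒≺ g⁺

    ∈T⁺⇒∼ : ∀ {h} → h ∈ T⁺ g → h ⁻¹ ∼ g ⁻¹
    ∈T⁺⇒∼ {h} (h⁺ , allO⁺) with total g h
    ... | inj₁ g≾h = ∼-sym (⁻¹-∼-of-O⁺-interval g⁺ h⁺ g≾h
                              λ x p q → allO⁺ x (inj₁ (p , q)))
    ... | inj₂ h≾g = ⁻¹-∼-of-O⁺-interval h⁺ g⁺ h≾g
                       λ x p q → allO⁺ x (inj₂ (p , q))

    -- As the bottoms agree, the inverse of the upper endpoint is strictly below everything between
    -- `g` and `h`, and `O⁺-below` applies.
    ∼⇒∈T⁺ : ∀ {h} → O⁺Type h → h ⁻¹ ∼ g ⁻¹ → h ∈ T⁺ g
    ∼⇒∈T⁺ {h} h⁺ h⁻¹∼g⁻¹ = h⁺ , λ where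
      x (inj₁ (g≾x , x≾h)) →
        O⁺-below (≾-≺-trans (proj₁ h⁻¹∼g⁻¹) (≺-≾-trans g⁻¹≺g g≾x)) x≾h
      x (inj₂ (h≾x , x≾g)) →
        O⁺-below (≾-≺-trans (proj₂ h⁻¹∼g⁻¹) (≺-≾-trans (⋨⇒≺ h⁺) h≾x)) x≾g

    ∈T⁺⇒≺ : ∀ {h} → h ∈ T⁺ g → g ⁻¹ ≺ h
    ∈T⁺⇒≺ h∈T⁺ = ≾-≺-trans (proj₂ (∈T⁺⇒∼ h∈T⁺)) (⋨⇒≺ (proj₁ h∈T⁺))

    ∈T⁻⇒∼ : ∀ {x} → x ∈ T⁻ g → x ∼ g ⁻¹
    ∈T⁻⇒∼ (h , h∈T⁺ , x≈h⁻¹) = ∼-trans (≈⇒∼ x≈h⁻¹) (∈T⁺⇒∼ h∈T⁺)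

    ∈T⁻⇒O⁻ : ∀ {x} → x ∈ T⁻ g → O⁻Type x
    ∈T⁻⇒O⁻ (h , (h⁺ , _) , x≈h⁻¹) = ≺⇒⋨
      (≾-≺-trans (≈⇒≾ x≈h⁻¹)
        (≺-≾-trans (⋨⇒≺ (O⁺⇒O⁻⁻¹ h⁺)) (≈⇒≾ (⁻¹-cong (sym x≈h⁻¹)))))

    ∼⇒∈T⁻ : ∀ {x} → O⁻Type x → x ∼ g ⁻¹ → x ∈ T⁻ g
    ∼⇒∈T⁻ {x} x⁻ x∼g⁻¹ = x ⁻¹ ,
      ∼⇒∈T⁺ (O⁻⇒O⁺⁻¹ x⁻) (∼-trans (≈⇒∼ (⁻¹⁻¹ x)) x∼g⁻¹) ,
      sym (⁻¹⁻¹ x)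

    g∈T : g ∈ T g
    g∈T = inj₁ (∼⇒∈T⁺ g⁺ (≾-refl , ≾-refl))

    g⁻¹∈T : g ⁻¹ ∈ T g
    g⁻¹∈T = inj₂ (∼⇒∈T⁻ (O⁺⇒O⁻⁻¹ g⁺) (≾-refl , ≾-refl))

    ∈T⇒≾ : ∀ {x} → x ∈ T g → g ⁻¹ ≾ x
    ∈T⇒≾ (inj₁ x∈T⁺) = ≺⇒≾ (∈T⁺⇒≺ x∈T⁺)
    ∈T⇒≾ (inj₂ x∈T⁻) = proj₂ (∈T⁻⇒∼ x∈T⁻)

    ∈T⇒¬V : ∀ {x} → x ∈ T g → ¬ VType x
    ∈T⇒¬V (inj₁ x∈T⁺) = O⁺⇒¬V (proj₁ x∈T⁺)
    ∈T⇒¬V (inj₂ x∈T⁻) = O⁻⇒¬V (∈T⁻⇒O⁻ x∈T⁻)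

    ∈T∧O⁺⇒∈T⁺ : ∀ {x} → x ∈ T g → O⁺Type x → x ∈ T⁺ g
    ∈T∧O⁺⇒∈T⁺ (inj₁ x∈T⁺) _  = x∈T⁺
    ∈T∧O⁺⇒∈T⁺ (inj₂ x∈T⁻) x⁺ =
      ⊥-elim (⋨⇒≺ x⁺ (proj₁ (∈T⁻⇒O⁻ x∈T⁻)))

    ∈T∧O⁻⇒∈T⁻ : ∀ {x} → x ∈ T g → O⁻Type x → x ∈ T⁻ g
    ∈T∧O⁻⇒∈T⁻ (inj₁ x∈T⁺) x⁻ = ⊥-elim (⋨⇒≺ x⁻ (proj₁ (proj₁ x∈T⁺)))
    ∈T∧O⁻⇒∈T⁻ (inj₂ x∈T⁻) _  = x∈T⁻

    -- Convexity, the convexity complement and welding.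

    T-rightConvex : RightConvex (T g)
    T-rightConvex {a = a} s∈T t∈T s⋨a a≾t = from-T t∈T
      where
      -- `g ⁻¹` is a minimum of `T g`, so `a` is strictly above it. This excludes `t ∈ T⁻ g`;
      -- otherwise `t ⁻¹ ≺ a ≾ t`, and the intervals of `a` and `t` overlap.
      g⁻¹≺a : g ⁻¹ ≺ a
      g⁻¹≺a = ≾-≺-trans (∈T⇒≾ s∈T) (⋨⇒≺ s⋨a)

      from-T : _ ∈ T g → a ∈ T g
      from-T (inj₂ t∈T⁻) = ⊥-elim (g⁻¹≺a (≾-trans a≾t (proj₁ (∈T⁻⇒∼ t∈T⁻))))
      from-T (inj₁ t∈T⁺) = inj₁ (∼⇒∈T⁺ a⁺ a⁻¹∼g⁻¹)
        where
        t⁻¹≺a : _ ⁻¹ ≺ a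
        t⁻¹≺a = ≾-≺-trans (proj₁ (∈T⁺⇒∼ t∈T⁺)) g⁻¹≺a

        a⁺ : O⁺Type a
        a⁺ = O⁺-below t⁻¹≺a a≾t

        a⁻¹∼g⁻¹ : a ⁻¹ ∼ g ⁻¹
        a⁻¹∼g⁻¹ = ∼-trans (⁻¹-∼-of-overlap a⁺ (proj₁ t∈T⁺) a≾t t⁻¹≺a)
                          (∈T⁺⇒∼ t∈T⁺)

    T∪F-convex : Convex (T g ∪ F g)
    T∪F-convex {s} {t} {a} s∈ t∈ s≾a a≾t with dec (a ≾ g ⁻¹)
    ... | yes a≾g⁻¹ with em {a ∈ T g}
    ...   | yes a∈T = inj₁ a∈T
    ...   | no  a∉T = inj₂ ((a≾g⁻¹ , ≾-trans (bounded s∈) s≾a) , a∉T)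
      where
      bounded : s ∈ T g ∪ F g → g ⁻¹ ≾ s
      bounded (inj₁ s∈T) = ∈T⇒≾ s∈T
      bounded (inj₂ s∈F) = proj₂ (proj₁ s∈F)
    T∪F-convex s∈ (inj₁ t∈T) s≾a a≾t | no g⁻¹≺a =
      -- `s` may lie in `F g`, so `g ⁻¹` replaces it as lower endpoint.
      inj₁ (T-rightConvex g⁻¹∈T t∈T (≺⇒⋨ g⁻¹≺a) a≾t)
    T∪F-convex s∈ (inj₂ t∈F) s≾a a≾t | no g⁻¹≺a =
      ⊥-elim (g⁻¹≺a (≾-trans a≾t (proj₁ (proj₁ t∈F))))

    F-complement : IsConvexityComplement (T g) (F g)
    F-complement = record
      { disjoint = λ (x∈T , (_ , x∉T)) → x∉T x∈T
      ; convex   = T∪F-convex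
      -- With both endpoints equal to `g ⁻¹`, convexity captures its whole class.
      ; smallest = λ T′ _ T∪T′-convex (x∼g⁻¹ , x∉T) →
          [ ⊥-elim ∘ x∉T , id ]′
            (T∪T′-convex (inj₁ g⁻¹∈T) (inj₁ g⁻¹∈T) (proj₂ x∼g⁻¹) (proj₁ x∼g⁻¹))
      }

    F⊆VType : F g ⊆ VType
    F⊆VType {x} (x∼g⁻¹ , x∉T) = decidable-stable (dec _) λ ¬v →
      -- An o⁺-type `x` in the class would make `g ⁻¹` o⁺-type as well.
      [ (λ x⁺ → ⋨⇒≺ (O⁺-below (≺-≾-trans (⋨⇒≺ x⁺) (proj₁ x∼g⁻¹)) (proj₂ x∼g⁻¹))
                    (proj₁ (O⁺⇒O⁻⁻¹ g⁺)))
      , (λ x⁻ → x∉T (inj₂ (∼⇒∈T⁻ x⁻ x∼g⁻¹)))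
      ]′ (¬V⇒O⁺⊎O⁻ ¬v)

    cl≐F∪T⁻ : cl (g ⁻¹) ≐ (F g ∪ T⁻ g)
    cl≐F∪T⁻ = ⊆-dir , [ proj₁ , ∈T⁻⇒∼ ]′
      where
      ⊆-dir : cl (g ⁻¹) ⊆ F g ∪ T⁻ g
      ⊆-dir {x} x∼g⁻¹ with em {x ∈ T g}
      ... | no  x∉T         = inj₁ (x∼g⁻¹ , x∉T)
      ... | yes (inj₂ x∈T⁻) = inj₂ x∈T⁻
      ... | yes (inj₁ x∈T⁺) = ⊥-elim (∈T⁺⇒≺ x∈T⁺ (proj₁ x∼g⁻¹))

    g⁻¹-¬V : ¬ VType (g ⁻¹)
    g⁻¹-¬V = ∈T⇒¬V g⁻¹∈T

    -- Since `g ⁻¹` is not v-type, welding means a v-type element in its class. A convex `T g`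
    -- contains that class but no v-type element; conversely, only elements of `F g`, all v-type,
    -- can obstruct convexity.
    T-convex⇔ : Convex (T g) ⇔ (¬ WeldingPoint (g ⁻¹))
    T-convex⇔ = mk⇔ to from
      where
      to : Convex (T g) → ¬ WeldingPoint (g ⁻¹)
      to T-convex (x , x∼g⁻¹ , inj₁ (v , _)) =
        ∈T⇒¬V (T-convex g⁻¹∈T g⁻¹∈T (proj₂ x∼g⁻¹) (proj₁ x∼g⁻¹)) v
      to _ (x , _ , inj₂ (_ , v)) = g⁻¹-¬V v

      from : ¬ WeldingPoint (g ⁻¹) → Convex (T g)
      from ¬weld s∈T t∈T s≾a a≾t
        with T∪F-convex (inj₁ s∈T) (inj₁ t∈T) s≾a a≾t
      ... | inj₁ a∈T = a∈T
      ... | inj₂ a∈F =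
        ⊥-elim (¬weld (_ , proj₁ a∈F , inj₁ (F⊆VType a∈F , inj₂ g⁻¹-¬V)))

    -- Characterisation of `T g` as the biggest candidate.

    T-candidate : IsOComponentCandidate g (T g)
    T-candidate = record
      { strictlyConvex = λ s∈T t∈T s⋨a a⋨t → T-rightConvex s∈T t∈T s⋨a (proj₁ a⋨t)
      ; contains-g     = g∈T
      ; avoids-ε       = λ x∈T x≈ε → ∈T⇒¬V x∈T (V-resp-≈ (sym x≈ε) ε-VType)
      ; all-OType      = inj₂ ∘ ∈T⇒¬V
      ; oneO⁻Class     =
          (g ⁻¹ , g⁻¹∈T , O⁺⇒O⁻⁻¹ g⁺) ,
          λ a∈T a⁻ b∈T b⁻ → ∼-trans (O⁻⇒∼ a∈T a⁻) (∼-sym (O⁻⇒∼ b∈T b⁻))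
      ; O⁻-below-O⁺    = λ a∈T a⁻ b∈T b⁺ → ≺⇒⋨
          (≾-≺-trans (proj₁ (O⁻⇒∼ a∈T a⁻)) (∈T⁺⇒≺ (∈T∧O⁺⇒∈T⁺ b∈T b⁺)))
      }
      where
      O⁻⇒∼ : ∀ {a} → a ∈ T g → O⁻Type a → a ∼ g ⁻¹
      O⁻⇒∼ a∈T a⁻ = ∈T⁻⇒∼ (∈T∧O⁻⇒∈T⁻ a∈T a⁻)

    T-biggest : (S : Subset) → IsOComponentCandidate g S → S ⊆ T g
    T-biggest S cand {x} x∈S =
      [ ⊥-elim ∘ avoids-ε x∈S
      , [ (λ x⁺ → inj₁ (∼⇒∈T⁺ x⁺ (O⁺-∼ x∈S x⁺)))
        , (λ x⁻ → inj₂ (∼⇒∈T⁻ x⁻ (O⁻-∼ x∈S x⁻)))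
        ]′ ∘ ¬V⇒O⁺⊎O⁻
      ]′ (all-OType x∈S)
      where
      open IsOComponentCandidate cand

      O⁻-∼ : ∀ {a} → a ∈ S → O⁻Type a → a ∼ g ⁻¹
      O⁻-∼ {a} a∈S a⁻ = ∼-dec
        -- `g ⁻¹` is strictly between `a` and `g`, giving a second o⁻-type class in `S`.
        (λ a≺g⁻¹ →
          a≺g⁻¹ (proj₂ (proj₂ oneO⁻Class a∈S a⁻
            (strictlyConvex a∈S contains-g (≺⇒⋨ a≺g⁻¹) g⁺) (O⁺⇒O⁻⁻¹ g⁺))))
        -- `g ⁻¹` is strictly below `a` and `a ⁻¹`, so `g ≺ a`, against `a ⋨ g`.
        (λ g⁻¹≺a →
          ⁻¹≺⇒≺ g⁻¹≺a (≺-≾-trans g⁻¹≺a (proj₁ a⁻))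
            (proj₁ (O⁻-below-O⁺ a∈S a⁻ contains-g g⁺)))

      O⁺-∼ : ∀ {b} → b ∈ S → O⁺Type b → b ⁻¹ ∼ g ⁻¹
      O⁺-∼ {b} b∈S b⁺ with proj₁ oneO⁻Class
      ... | a , a∈S , a⁻ = ∼-dec
        -- `b ⁻¹` is strictly below `g` and `g ⁻¹`, so `b ≺ g ⁻¹`, against `g ⁻¹ ∼ a ⋨ b`.
        (λ b⁻¹≺g⁻¹ →
          ⁻¹≺⇒≺⁻¹ (≺-≾-trans b⁻¹≺g⁻¹ (proj₁ g⁺)) b⁻¹≺g⁻¹
            (≾-trans (proj₂ a∼g⁻¹) (proj₁ (O⁻-below-O⁺ a∈S a⁻ b∈S b⁺))))
        -- `b ⁻¹` is strictly between `a` and `b`, hence an o⁻-type element of `S`.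
        (λ g⁻¹≺b⁻¹ →
          g⁻¹≺b⁻¹ (proj₁ (O⁻-∼
            (strictlyConvex a∈S b∈S (≺⇒⋨ (≾-≺-trans (proj₁ a∼g⁻¹) g⁻¹≺b⁻¹)) b⁺)
            (O⁺⇒O⁻⁻¹ b⁺))))
        where
        a∼g⁻¹ : a ∼ g ⁻¹
        a∼g⁻¹ = O⁻-∼ a∈S a⁻

    ⁻¹≺-T⁺ : ∀ {f h} → f ∈ T⁺ g → h ∈ T⁺ g → h ⁻¹ ≺ f
    ⁻¹≺-T⁺ f∈T⁺ h∈T⁺ = ≾-≺-trans (proj₁ (∈T⁺⇒∼ h∈T⁺)) (∈T⁺⇒≺ f∈T⁺)

  -- Monotonicity of multiplication.

  C⇒≺-of-≺ : ∀ {a b d} → d ≺ b → C a b d → b ≺ a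
  -- Branching at `ε`: the alternative `C ε d b` clashes with `d ≺ b`, so `ε` takes the place of
  -- `d`.
  C⇒≺-of-≺ d≺b a∣b,d with branch _ _ _ ε (C-swap _ _ _ a∣b,d)
  ... | inj₁ ε∣d,b = ⊥-elim
    (asym _ _ _ (C-swap _ _ _ (≺⇒C d≺b)) (C-swap _ _ _ ε∣d,b))
  ... | inj₂ a∣ε,b = C⇒≺ (C-swap _ _ _ a∣ε,b)

  -- By contradiction: cancelling `h` in `C (a ∙ h) (b ∙ h) ε` yields `C a b (h ⁻¹)`, where `h ⁻¹`
  -- may be exchanged for `ε`.
  ∙-monoʳ-≾ : ∀ {a b h} → h ⁻¹ ≺ b → a ≾ b → a ∙ h ≾ b ∙ h
  ∙-monoʳ-≾ {a} {b} {h} h⁻¹≺b a≾b = decidable-stable (dec _) λ bh≺ah →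
    C⇒≺-of-≺ h⁻¹≺b
      (resp (cancel a) (cancel b) (trans (∙-congʳ (identityˡ ε)) (identityˡ _))
        (compatible _ _ _ (h ⁻¹) ε (≺⇒C bh≺ah)))
      a≾b
    where
    cancel : ∀ x → ε ∙ (x ∙ h) ∙ h ⁻¹ ≈ x
    cancel x = trans (∙-congʳ (identityˡ _)) (//-rightDividesʳ group h x)

  ∙-monoˡ-≾ : ∀ {a b h} → h ⁻¹ ≺ b → a ≾ b → h ∙ a ≾ h ∙ b
  ∙-monoˡ-≾ {a} {b} {h} h⁻¹≺b a≾b = decidable-stable (dec _) λ hb≺ha →
    C⇒≺-of-≺ h⁻¹≺b
      (resp (cancel a) (cancel b) (trans (identityʳ _) (identityʳ _))
        (compatible _ _ _ ε (h ⁻¹) (≺⇒C hb≺ha)))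
      a≾b
    where
    cancel : ∀ x → h ⁻¹ ∙ (h ∙ x) ∙ ε ≈ x
    cancel x = trans (identityʳ _) (\\-leftDividesʳ group h x)

proposition3p15 : {c ℓ r : Level} → ExcludedMiddle (c ⊔ ℓ ⊔ r) →
    (𝓖 : CQuasiOrderedGroup c ℓ r) →
    let open CQO 𝓖 in
    (g : Carrier) → O⁺Type g →
    ( RightConvex (T g)
    × IsConvexityComplement (T g) (F g)
    × cl (g ⁻¹) ≐ (F g ∪ T⁻ g)
    × F g ⊆ VType )
    × ( Convex (T g) ⇔ (¬ WeldingPoint (g ⁻¹)) )
    × IsBiggest (IsOComponentCandidate g) (T g)
    × ( ∀ {f₁ f₂ h} → f₁ ∈ T g → f₂ ∈ T g → h ∈ T g →
    O⁺Type f₁ → O⁺Type f₂ → O⁺Type h →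
    f₁ ≾ f₂ → (f₁ ∙ h ≾ f₂ ∙ h) × (h ∙ f₁ ≾ h ∙ f₂) )
proposition3p15 em 𝓖 g g⁺ =
    (T-rightConvex , F-complement , cl≐F∪T⁻ , F⊆VType)
  , T-convex⇔
  , (T-candidate , T-biggest)
  , λ _ f₂∈T h∈T _ f₂⁺ h⁺ f₁≾f₂ →
      let h⁻¹≺f₂ = ⁻¹≺-T⁺ (∈T∧O⁺⇒∈T⁺ f₂∈T f₂⁺) (∈T∧O⁺⇒∈T⁺ h∈T h⁺)
      in ∙-monoʳ-≾ h⁻¹≺f₂ f₁≾f₂ , ∙-monoˡ-≾ h⁻¹≺f₂ f₁≾f₂
  where
  open Classical em 𝓖
  open Component g g⁺
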